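{- There is an absolute constant $K$ such that for every $n\ge 2$ there exists a distribution $\mathcal{D}$ over infinite walk schedules over $[n]$ such that, if $\mathbf{x},\mathbf{y}$ are drawn independently from $\mathcal{D}$ and $\pi$ is a uniformly random permutation of $[n]$ independent of them, then $\Pr(\tau\le 4n)\ge 1-K/\log n$, where $\tau=\min\{t: x_t=\pi(y_t)\}$.
   Context: Rendezvous on the complete graph $K_n$: there are $n$ locations; each of two players labels them privately by $[n]$, and the labelings differ by a uniformly random permutation $\pi$ of $[n]$. A walk schedule is a sequence of labels; a player with schedule $\mathbf{x}$ visits at step $t$ the location she labels $x_t$, and the players meet at step $t$ iff $x_t=\pi(y_t)$. A symmetric strategy is one in which both players independently sample their schedules from the same distribution $\mathcal{D}$. -}

module Defs where

open import Data.Nat using (ℕ; zero; suc; _+_; _*_)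
open import Data.Fin using (Fin; _≟_)
open import Data.Fin.Properties using (≡-decSetoid)
open import Data.Bool using (Bool; true; false; if_then_else_; _∨_)
open import Data.List using (List; []; _∷_; concatMap; map; filter; length)
open import Data.Nat.ListAction using (sum)
open import Data.List.Base using (allFin)
open import Data.Vec using (Vec; []; _∷_; lookup; toList)
open import Data.List.Relation.Unary.Unique.DecSetoid using (unique?)
open import Relation.Nullary.Decidable using (does)

schedules : (n k : ℕ) → List (Vec (Fin n) k)
schedules n zero    = [] ∷ []
schedules n (suc k) = concatMap (λ a → map (a ∷_) (schedules n k)) (allFin n)

-- All permutations of [n], as vectors p with π(i) = lookup p i (injective, hence bijective).
perms : (n : ℕ) → List (Vec (Fin n) n)
perms n = filter (λ p → unique? (≡-decSetoid n) (toList p)) (schedules n n)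

meets : {n k : ℕ} → Vec (Fin n) n → Vec (Fin n) k → Vec (Fin n) k → Bool
meets p []       []       = false
meets p (x ∷ xs) (y ∷ ys) = does (x ≟ lookup p y) ∨ meets p xs ys

-- A (rational-valued) distribution on schedules of length k, given by natural
-- weights w; probability of x is w x / totalWeight w.
totalWeight : {n k : ℕ} → (Vec (Fin n) k → ℕ) → ℕ
totalWeight {n} {k} w = sum (map w (schedules n k))

successMass : {n k : ℕ} → (Vec (Fin n) k → ℕ) → ℕ
successMass {n} {k} w =
  sum (map (λ x → sum (map (λ y → sum (map (λ p →
    if meets p x y then w x * w y else 0) (perms n))) (schedules n k))) (schedules n k))

{-# OPTIONS --safe #-}
module Submission where

-- Write a time step as a block q < Q together with a string of M bits. A player draws a type j < M
-- and a waiting label c uniformly. She waits at c whenever bit j is 1 and explores whenever bit j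
-- is 0. While exploring she is at the label coded by q and the remaining M − 1 bits up to
-- complementation, so every label is visited at two times of its block whose bits differ everywhere
-- except at j. Hence, for every type i ≠ j, the player of type i is waiting at one of the two, and
-- the players meet as soon as the waiting place is among the Q 2^(M−2) labels explored. With
-- M ≈ (log n)/2 and Q = ⌊n / 2^(M−2)⌋ this takes at most 4n steps, the types coincide with
-- probability 1/M, and the waiting place is unexplored with probability at most 2^(M−2)/n.

open import Defs
open import Data.Bool using (Bool; true; false; if_then_else_)
open import Data.Fin using (Fin; zero; suc; _≟_; toℕ; fromℕ<; inject≤; opposite; combine; remQuot; finToFun; funToFin; punchIn; punchOut)
open import Data.Fin.Properties using (toℕ<n; toℕ-inject≤; fromℕ<-toℕ; fromℕ<-cong; inject≤-injective; remQuot-combine; combine-remQuot; funToFin-finToFin; finToFun-funToFin; punchIn-injective; punchInᵢ≢i; punchOut-injective; punchIn-punchOut; injective⇒≤; any?; ≡-decSetoid)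
open import Data.List using (List; []; _∷_; _++_; map; length; concatMap; cartesianProduct; allFin)
open import Data.List.Membership.Propositional using (_∈_)
open import Data.List.Membership.Propositional.Properties using (∈-filter⁻)
open import Data.List.Properties using (map-cong; map-∘; map-++; map-tabulate; length-tabulate; length-++; length-map)
open import Data.List.Relation.Unary.All as All using ()
open import Data.List.Relation.Unary.AllPairs using (_∷_)
open import Data.List.Relation.Unary.Any using (here; there)
open import Data.List.Relation.Unary.Unique.DecSetoid using (unique?)
open import Data.List.Relation.Unary.Unique.Propositional using (Unique)
open import Data.Nat using (ℕ; zero; suc; _+_; _*_; _^_; _≤_; _<_; z≤n; s≤s; _<?_; ⌊_/2⌋; ⌈_/2⌉; NonZero; _/_)
open import Data.Nat.DivMod using (m≡m%n+[m/n]*n; m%n≤n; m/n*n≤m)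
open import Data.Nat.ListAction using (sum)
open import Data.Nat.ListAction.Properties using (sum-++)
open import Data.Nat.Logarithm using (⌊log₂_⌋)
open import Data.Nat.Logarithm.Core using (⌊log2⌋)
open import Data.Nat.Induction using (<-wellFounded)
open import Data.Nat.Properties hiding (_≟_; _<?_; ≡-decSetoid)
open import Data.Nat.Tactic.RingSolver using (solve-∀)
open import Data.Product using (_×_; _,_; ∃-syntax; proj₁; proj₂)
open import Data.Vec using (Vec; []; _∷_; lookup; tabulate; toList)
open import Data.Vec.Functional using (insertAt; removeAt) renaming (_∷_ to _◂_)
open import Data.Vec.Functional.Properties using (insertAt-lookup; insertAt-punchIn; removeAt-insertAt)
open import Data.Vec.Membership.Propositional.Properties using (∈-lookup; ∈-toList⁺)
open import Data.Vec.Properties using (lookup∘tabulate)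
open import Function using (_∘_; Injective)
open import Induction.WellFounded using (Acc; acc)
open import Relation.Binary.PropositionalEquality using (_≡_; _≢_; _≗_; refl; sym; trans; cong; cong₂; subst; module ≡-Reasoning)
open import Relation.Nullary using (yes; no; contradiction)
open import Relation.Nullary.Decidable using (does; dec-true)

private
  variable
    A B : Set
    k m n : ℕ

-- Finite sums over lists

∑ : List A → (A → ℕ) → ℕ
∑ xs f = sum (map f xs)

∑-cong : {f g : A → ℕ} → f ≗ g → ∀ xs → ∑ xs f ≡ ∑ xs g
∑-cong f≗g xs = cong sum (map-cong f≗g xs)

-- The inequality is asked for members of the list only: meetings are bounded below for
-- `p ∈ perms n`, where membership supplies injectivity.
∑-mono-≤ : {f g : A → ℕ} (xs : List A) → (∀ {x} → x ∈ xs → f x ≤ g x) → ∑ xs f ≤ ∑ xs g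
∑-mono-≤ []       _   = z≤n
∑-mono-≤ (x ∷ xs) f≤g = +-mono-≤ (f≤g (here refl)) (∑-mono-≤ xs (f≤g ∘ there))

∑-const : (xs : List A) (c : ℕ) → ∑ xs (λ _ → c) ≡ length xs * c
∑-const []       c = refl
∑-const (x ∷ xs) c = cong (c +_) (∑-const xs c)

∑-distrib-+ : (f g : A → ℕ) (xs : List A) → ∑ xs (λ x → f x + g x) ≡ ∑ xs f + ∑ xs g
∑-distrib-+ f g []       = refl
∑-distrib-+ f g (x ∷ xs) = begin
  f x + g x + ∑ xs (λ x → f x + g x)  ≡⟨ cong (f x + g x +_) (∑-distrib-+ f g xs) ⟩
  f x + g x + (∑ xs f + ∑ xs g)       ≡⟨ interchange (f x) (g x) (∑ xs f) (∑ xs g) ⟩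
  f x + ∑ xs f + (g x + ∑ xs g)       ∎
  where
  open ≡-Reasoning
  interchange : ∀ a b c d → a + b + (c + d) ≡ a + c + (b + d)
  interchange = solve-∀

*-distribˡ-∑ : (c : ℕ) (f : A → ℕ) (xs : List A) → c * ∑ xs f ≡ ∑ xs (λ x → c * f x)
*-distribˡ-∑ c f []       = *-zeroʳ c
*-distribˡ-∑ c f (x ∷ xs) = trans (*-distribˡ-+ c (f x) _) (cong (c * f x +_) (*-distribˡ-∑ c f xs))

*-distribʳ-∑ : (c : ℕ) (f : A → ℕ) (xs : List A) → ∑ xs f * c ≡ ∑ xs (λ x → f x * c)
*-distribʳ-∑ c f []       = refl
*-distribʳ-∑ c f (x ∷ xs) = trans (*-distribʳ-+ c (f x) _) (cong (f x * c +_) (*-distribʳ-∑ c f xs))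

∑-comm : (f : A → B → ℕ) (xs : List A) (ys : List B) →
         ∑ xs (λ x → ∑ ys (f x)) ≡ ∑ ys (λ y → ∑ xs (λ x → f x y))
∑-comm f []       ys = sym (trans (∑-const ys 0) (*-zeroʳ (length ys)))
∑-comm f (x ∷ xs) ys = begin
  ∑ ys (f x) + ∑ xs (λ x → ∑ ys (f x))          ≡⟨ cong (∑ ys (f x) +_) (∑-comm f xs ys) ⟩
  ∑ ys (f x) + ∑ ys (λ y → ∑ xs (λ x → f x y))  ≡⟨ ∑-distrib-+ (f x) _ ys ⟨
  ∑ ys (λ y → ∑ (x ∷ xs) (λ x → f x y))         ∎
  where open ≡-Reasoning

∑-++ : (f : A → ℕ) (xs ys : List A) → ∑ (xs ++ ys) f ≡ ∑ xs f + ∑ ys f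
∑-++ f xs ys = trans (cong sum (map-++ f xs ys)) (sum-++ (map f xs) (map f ys))

∑-map : (f : B → ℕ) (g : A → B) (xs : List A) → ∑ (map g xs) f ≡ ∑ xs (f ∘ g)
∑-map f g xs = cong sum (sym (map-∘ xs))

∑-concatMap : (f : B → ℕ) (g : A → List B) (xs : List A) →
              ∑ (concatMap g xs) f ≡ ∑ xs (λ x → ∑ (g x) f)
∑-concatMap f g []       = refl
∑-concatMap f g (x ∷ xs) = trans (∑-++ f (g x) _) (cong (∑ (g x) f +_) (∑-concatMap f g xs))

∑-cartesianProduct : (f : A × B → ℕ) (xs : List A) (ys : List B) →
                     ∑ (cartesianProduct xs ys) f ≡ ∑ xs (λ x → ∑ ys (λ y → f (x , y)))
∑-cartesianProduct f []       ys = refl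
∑-cartesianProduct f (x ∷ xs) ys = trans (∑-++ f (map (x ,_) ys) _)
  (cong₂ _+_ (∑-map f (x ,_) ys) (∑-cartesianProduct f xs ys))

length-cartesianProduct : (xs : List A) (ys : List B) →
                          length (cartesianProduct xs ys) ≡ length xs * length ys
length-cartesianProduct []       ys = refl
length-cartesianProduct (x ∷ xs) ys = trans (length-++ (map (x ,_) ys))
  (cong₂ _+_ (length-map (x ,_) ys) (length-cartesianProduct xs ys))

-- Sums over `Fin n`

length-allFin : ∀ n → length (allFin n) ≡ n
length-allFin n = length-tabulate {n = n} (λ i → i)

∑-allFin-const : ∀ n c → ∑ (allFin n) (λ _ → c) ≡ n * c
∑-allFin-const n c = trans (∑-const (allFin n) c) (cong (_* c) (length-allFin n))

∑-allFin-suc : (f : Fin (suc n) → ℕ) → ∑ (allFin (suc n)) f ≡ f zero + ∑ (allFin n) (f ∘ suc)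
∑-allFin-suc f = cong (λ z → f zero + sum z)
  (trans (map-tabulate suc f) (sym (map-tabulate (λ i → i) (f ∘ suc))))

∑-removeAt : (f : Fin (suc n) → ℕ) (i : Fin (suc n)) →
             ∑ (allFin (suc n)) f ≡ f i + ∑ (allFin n) (removeAt f i)
∑-removeAt         f zero    = ∑-allFin-suc f
∑-removeAt {suc n} f (suc i) = begin
  ∑ (allFin (2 + n)) f                        ≡⟨ ∑-allFin-suc f ⟩
  f zero + ∑ (allFin (suc n)) (f ∘ suc)       ≡⟨ cong (f zero +_) (∑-removeAt (f ∘ suc) i) ⟩
  f zero + (f (suc i) + rest)                 ≡⟨ swap (f zero) (f (suc i)) rest ⟩
  f (suc i) + (f zero + rest)                 ≡⟨ cong (f (suc i) +_) (∑-allFin-suc (removeAt f (suc i))) ⟨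
  f (suc i) + ∑ (allFin (suc n)) (removeAt f (suc i)) ∎
  where
  open ≡-Reasoning
  rest = ∑ (allFin n) (removeAt (f ∘ suc) i)
  swap : ∀ a b c → a + (b + c) ≡ b + (a + c)
  swap = solve-∀

-- Each value of `g` is deleted from the index set together with its term, and `punchOut` renumbers
-- the later values; injectivity keeps them off the deleted index. This serves both to count waiting
-- labels within one type and to sum over the types different from a given one.
∑-injection : (f : Fin n → ℕ) (g : Fin m → Fin n) → Injective _≡_ _≡_ g →
              (c : ℕ) → (∀ i → c ≤ f (g i)) → m * c ≤ ∑ (allFin n) f
∑-injection         {m = zero}  f g inj c c≤ = z≤n
∑-injection {zero}  {m = suc m} f g inj c c≤ with () ← g zero
∑-injection {suc n} {m = suc m} f g inj c c≤ = begin
  c + m * c                                   ≤⟨ +-mono-≤ (c≤ zero) (∑-injection (removeAt f g₀) h h-inj c c≤h) ⟩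
  f g₀ + ∑ (allFin n) (removeAt f g₀)         ≡⟨ ∑-removeAt f g₀ ⟨
  ∑ (allFin (suc n)) f                        ∎
  where
  open ≤-Reasoning
  g₀ = g zero
  g₀≢ : ∀ i → g₀ ≢ g (suc i)
  g₀≢ i eq with () ← inj eq
  h : Fin m → Fin n
  h i = punchOut (g₀≢ i)
  h-inj : Injective _≡_ _≡_ h
  h-inj eq with refl ← inj (punchOut-injective (g₀≢ _) (g₀≢ _) eq) = refl
  c≤h : ∀ i → c ≤ f (punchIn g₀ (h i))
  c≤h i = subst (λ z → c ≤ f z) (sym (punchIn-punchOut (g₀≢ i))) (c≤ (suc i))

-- Point masses and empirical distributions

δFin : Fin n → Fin n → ℕ
δFin zero    zero    = 1
δFin zero    (suc _) = 0
δFin (suc _) zero    = 0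
δFin (suc i) (suc j) = δFin i j

∑-δFin : (a : Fin n) (f : Fin n → ℕ) → ∑ (allFin n) (λ b → δFin b a * f b) ≡ f a
∑-δFin {suc n} zero f = begin
  ∑ (allFin (suc n)) (λ b → δFin b zero * f b)  ≡⟨ ∑-allFin-suc (λ b → δFin b zero * f b) ⟩
  1 * f zero + ∑ (allFin n) (λ _ → 0)            ≡⟨ cong₂ _+_ (*-identityˡ (f zero)) (∑-const (allFin n) 0) ⟩
  f zero + length (allFin n) * 0                 ≡⟨ cong (f zero +_) (*-zeroʳ (length (allFin n))) ⟩
  f zero + 0                                     ≡⟨ +-identityʳ (f zero) ⟩
  f zero                                         ∎
  where open ≡-Reasoning
∑-δFin (suc a) f = trans (∑-allFin-suc (λ b → δFin b (suc a) * f b)) (∑-δFin a (f ∘ suc))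

δ : Vec (Fin n) k → Vec (Fin n) k → ℕ
δ []       []       = 1
δ (x ∷ xs) (y ∷ ys) = δFin x y * δ xs ys

-- The delta factors over coordinates, so the sum collapses one entry at a time. In effect,
-- `schedules n k` lists every vector exactly once.
∑-δ : (y : Vec (Fin n) k) (f : Vec (Fin n) k → ℕ) → ∑ (schedules n k) (λ x → δ x y * f x) ≡ f y
∑-δ []                   f = trans (+-identityʳ _) (*-identityˡ _)
∑-δ {n} {suc k} (a ∷ y)  f = begin
  ∑ (schedules n (suc k)) F
    ≡⟨ ∑-concatMap F (λ b → map (b ∷_) (schedules n k)) (allFin n) ⟩
  ∑ (allFin n) (λ b → ∑ (map (b ∷_) (schedules n k)) F)
    ≡⟨ ∑-cong (λ b → trans (∑-map F (b ∷_) (schedules n k)) (inner b)) (allFin n) ⟩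
  ∑ (allFin n) (λ b → δFin b a * f (b ∷ y))
    ≡⟨ ∑-δFin a (λ b → f (b ∷ y)) ⟩
  f (a ∷ y) ∎
  where
  open ≡-Reasoning
  F = λ x → δ x (a ∷ y) * f x
  inner : ∀ b → ∑ (schedules n k) (λ x → δFin b a * δ x y * f (b ∷ x)) ≡ δFin b a * f (b ∷ y)
  inner b = begin
    ∑ (schedules n k) (λ x → δFin b a * δ x y * f (b ∷ x))
      ≡⟨ ∑-cong (λ x → *-assoc (δFin b a) (δ x y) (f (b ∷ x))) (schedules n k) ⟩
    ∑ (schedules n k) (λ x → δFin b a * (δ x y * f (b ∷ x)))
      ≡⟨ *-distribˡ-∑ (δFin b a) _ (schedules n k) ⟨
    δFin b a * ∑ (schedules n k) (λ x → δ x y * f (b ∷ x))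
      ≡⟨ cong (δFin b a *_) (∑-δ y (λ x → f (b ∷ x))) ⟩
    δFin b a * f (b ∷ y) ∎

𝟙 : Bool → ℕ
𝟙 b = if b then 1 else 0

-- The law of s i for i drawn uniformly from the list is.
module Empirical {I : Set} (is : List I) (s : I → Vec (Fin n) k) where

  weight : Vec (Fin n) k → ℕ
  weight x = ∑ is (λ i → δ x (s i))

  -- Exchanging the sums leaves a point mass at each `s i`. A schedule produced by several indices
  -- is counted with multiplicity on both sides.
  ∑-weight : (f : Vec (Fin n) k → ℕ) → ∑ (schedules n k) (λ x → weight x * f x) ≡ ∑ is (f ∘ s)
  ∑-weight f = begin
    ∑ (schedules n k) (λ x → weight x * f x)
      ≡⟨ ∑-cong (λ x → *-distribʳ-∑ (f x) (λ i → δ x (s i)) is) (schedules n k) ⟩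
    ∑ (schedules n k) (λ x → ∑ is (λ i → δ x (s i) * f x))
      ≡⟨ ∑-comm (λ x i → δ x (s i) * f x) (schedules n k) is ⟩
    ∑ is (λ i → ∑ (schedules n k) (λ x → δ x (s i) * f x))
      ≡⟨ ∑-cong (λ i → ∑-δ (s i) f) is ⟩
    ∑ is (f ∘ s) ∎
    where open ≡-Reasoning

  totalWeight-weight : totalWeight weight ≡ length is
  totalWeight-weight = begin
    ∑ (schedules n k) weight                  ≡⟨ ∑-cong (λ x → sym (*-identityʳ (weight x))) (schedules n k) ⟩
    ∑ (schedules n k) (λ x → weight x * 1)    ≡⟨ ∑-weight (λ _ → 1) ⟩
    ∑ is (λ _ → 1)                            ≡⟨ ∑-const is 1 ⟩
    length is * 1                             ≡⟨ *-identityʳ (length is) ⟩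
    length is                                 ∎
    where open ≡-Reasoning

  -- With the permutation outermost, it is enough to count meeting pairs of indices for each fixed
  -- permutation.
  successMass-weight : successMass weight ≡
    ∑ (perms n) (λ p → ∑ is (λ i → ∑ is (λ j → 𝟙 (meets p (s i) (s j)))))
  successMass-weight = begin
    ∑ X (λ x → ∑ X (λ y → ∑ P (λ p → if meets p x y then weight x * weight y else 0)))
      ≡⟨ ∑-cong (λ x → ∑-cong (λ y → ∑-cong (λ p → split (meets p x y) (weight x) (weight y)) P) X) X ⟩
    ∑ X (λ x → ∑ X (λ y → ∑ P (λ p → weight x * (weight y * 𝟙 (meets p x y)))))
      ≡⟨ ∑-cong (λ x → ∑-comm (λ y p → weight x * (weight y * 𝟙 (meets p x y))) X P) X ⟩
    ∑ X (λ x → ∑ P (λ p → ∑ X (λ y → weight x * (weight y * 𝟙 (meets p x y)))))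
      ≡⟨ ∑-comm _ X P ⟩
    ∑ P (λ p → ∑ X (λ x → ∑ X (λ y → weight x * (weight y * 𝟙 (meets p x y)))))
      ≡⟨ ∑-cong (λ p → ∑-cong (λ x → sym (*-distribˡ-∑ (weight x) _ X)) X) P ⟩
    ∑ P (λ p → ∑ X (λ x → weight x * ∑ X (λ y → weight y * 𝟙 (meets p x y))))
      ≡⟨ ∑-cong (λ p → ∑-weight (λ x → ∑ X (λ y → weight y * 𝟙 (meets p x y)))) P ⟩
    ∑ P (λ p → ∑ is (λ i → ∑ X (λ y → weight y * 𝟙 (meets p (s i) y))))
      ≡⟨ ∑-cong (λ p → ∑-cong (λ i → ∑-weight (λ y → 𝟙 (meets p (s i) y))) is) P ⟩
    ∑ P (λ p → ∑ is (λ i → ∑ is (λ j → 𝟙 (meets p (s i) (s j))))) ∎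
    where
    open ≡-Reasoning
    X = schedules n k
    P = perms n
    split : ∀ b u v → (if b then u * v else 0) ≡ u * (v * 𝟙 b)
    split true  u v = cong (u *_) (sym (*-identityʳ v))
    split false u v = sym (trans (cong (u *_) (*-zeroʳ v)) (*-zeroʳ u))

-- Permutations and meetings

unique⇒lookup-injective : (p : Vec A k) → Unique (toList p) → Injective _≡_ _≡_ (lookup p)
unique⇒lookup-injective (x ∷ p) (x∉p ∷ u) {zero}  {zero}  eq = refl
unique⇒lookup-injective (x ∷ p) (x∉p ∷ u) {zero}  {suc j} eq =
  contradiction eq (All.lookup x∉p (∈-toList⁺ (∈-lookup j p)))
unique⇒lookup-injective (x ∷ p) (x∉p ∷ u) {suc i} {zero}  eq =
  contradiction (sym eq) (All.lookup x∉p (∈-toList⁺ (∈-lookup i p)))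
unique⇒lookup-injective (x ∷ p) (x∉p ∷ u) {suc i} {suc j} eq =
  cong suc (unique⇒lookup-injective p u eq)

perms-injective : {p : Vec (Fin n) n} → p ∈ perms n → Injective _≡_ _≡_ (lookup p)
perms-injective {n} {p} p∈ = unique⇒lookup-injective p
  (proj₂ (∈-filter⁻ (λ p → unique? (≡-decSetoid n) (toList p)) {xs = schedules n n} p∈))

-- Pigeonhole: if `y` were missed, punching it out would inject `Fin (suc n)` into `Fin n`.
injective⇒surjective : (f : Fin n → Fin n) → Injective _≡_ _≡_ f → ∀ y → ∃[ x ] f x ≡ y
injective⇒surjective {suc n} f inj y with any? (λ x → f x ≟ y)
... | yes hit  = hit
... | no  miss = contradiction
  (injective⇒≤ {f = λ x → punchOut (y≢ x)} (inj ∘ punchOut-injective (y≢ _) (y≢ _)))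
  1+n≰n
  where
  y≢ : ∀ x → y ≢ f x
  y≢ x eq = miss (x , sym eq)

meets-at : (p : Vec (Fin n) n) (x y : Vec (Fin n) k) (t : Fin k) →
           lookup x t ≡ lookup p (lookup y t) → meets p x y ≡ true
meets-at p (x ∷ xs) (y ∷ ys) zero    eq rewrite dec-true (x ≟ lookup p y) eq = refl
meets-at p (x ∷ xs) (y ∷ ys) (suc t) eq with does (x ≟ lookup p y)
... | true  = refl
... | false = meets-at p xs ys t eq

-- Bit strings up to complementation

funToFin-cong : {f g : Fin m → Fin n} → f ≗ g → funToFin f ≡ funToFin g
funToFin-cong {zero}  f≗g = refl
funToFin-cong {suc m} f≗g = cong₂ combine (f≗g zero) (funToFin-cong (f≗g ∘ suc))

-- Exclusive or: `opposite` swaps the two elements of `Fin 2`.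
_⊕_ : Fin 2 → Fin 2 → Fin 2
a ⊕ zero  = a
a ⊕ suc _ = opposite a

⊕-cancelʳ : ∀ a b → (a ⊕ b) ⊕ b ≡ a
⊕-cancelʳ zero       zero       = refl
⊕-cancelʳ zero       (suc zero) = refl
⊕-cancelʳ (suc zero) zero       = refl
⊕-cancelʳ (suc zero) (suc zero) = refl

-- The two bit strings that collapse to v; they are complementary.
lift⊕ : (Fin m → Fin 2) → Fin 2 → Fin (suc m) → Fin 2
lift⊕ v b = b ◂ (λ i → v i ⊕ b)

-- Of `g` and its complement, the one with first bit 0 is kept and that bit is dropped; hence
-- complementary strings have the same value.
collapse : (Fin (suc m) → Fin 2) → Fin m → Fin 2
collapse g i = g (suc i) ⊕ g zero

-- The lifts for the two values of `b` differ at every position, so one of them has a 1 at `i`.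
lift⊕-hits-1 : (v : Fin m → Fin 2) (i : Fin (suc m)) → ∃[ b ] lift⊕ v b i ≡ suc zero
lift⊕-hits-1 v zero    = suc zero , refl
lift⊕-hits-1 v (suc i) with v i in eq
... | zero     = suc zero , refl
... | suc zero = zero , refl

choose : Fin 2 → A → A → A
choose zero    a b = a
choose (suc _) a b = b

extend : (Fin m → A) → A → Fin k → A
extend {m = m} f a t with toℕ t <? m
... | yes t<m = f (fromℕ< t<m)
... | no  _   = a

extend-inject≤ : (f : Fin m → A) (a : A) (t : Fin m) (m≤k : m ≤ k) → extend f a (inject≤ t m≤k) ≡ f t
extend-inject≤ {m = m} f a t m≤k with toℕ (inject≤ t m≤k) <? m
... | yes lt = cong f (trans (fromℕ<-cong _ _ (toℕ-inject≤ t m≤k) lt (toℕ<n t)) (fromℕ<-toℕ t (toℕ<n t)))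
... | no ¬lt = contradiction (subst (_< m) (sym (toℕ-inject≤ t m≤k)) (toℕ<n t)) ¬lt

-- The wait-or-explore strategy

module Strategy (Q m n : ℕ) (N≤n : Q * 2 ^ m ≤ n) where

  -- A label within its block takes `m` bits; one more bit is lost to complementation and one to the
  -- bit that belongs to the type.
  M = 2 + m

  N = Q * 2 ^ m

  -- This is 4 `N`: half of the steps are for waiting, and the other half visit each of the `N`
  -- labels twice.
  T = Q * 2 ^ M

  T≤4n : T ≤ 4 * n
  T≤4n = ≤-trans (≤-reflexive (regroup Q (2 ^ m))) (*-monoʳ-≤ 4 N≤n)
    where
    regroup : ∀ q r → q * (2 * (2 * r)) ≡ 4 * (q * r)
    regroup = solve-∀

  label : Fin N → Fin n
  label ℓ = inject≤ ℓ N≤n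

  position : Fin M → Fin n → Fin Q → (Fin M → Fin 2) → Fin n
  position j c q f = choose (f j) (label (combine q (funToFin (collapse (removeAt f j))))) c

  position-cong : ∀ j c q {f g} → f ≗ g → position j c q f ≡ position j c q g
  position-cong j c q f≗g = cong₂ (λ b v → choose b (label (combine q v)) c) (f≗g j)
    (funToFin-cong (λ i → cong₂ _⊕_ (f≗g (punchIn j (suc i))) (f≗g (punchIn j zero))))

  walk : Fin M → Fin n → Fin T → Fin n
  walk j c t = let q , s = remQuot (2 ^ M) t in position j c q (finToFun s)

  schedule : Fin M × Fin n → Vec (Fin n) (4 * n)
  -- Any steps from `T` up to `4 * n` are spent at the waiting label.
  schedule (j , c) = tabulate (extend (walk j c) c)

  instant : Fin Q → (Fin M → Fin 2) → Fin (4 * n)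
  instant q f = inject≤ (combine q (funToFin f)) T≤4n

  lookup-schedule : ∀ j c q f → lookup (schedule (j , c)) (instant q f) ≡ position j c q f
  lookup-schedule j c q f = begin
    lookup (schedule (j , c)) (instant q f)   ≡⟨ lookup∘tabulate _ (instant q f) ⟩
    extend (walk j c) c (instant q f)         ≡⟨ extend-inject≤ (walk j c) c _ T≤4n ⟩
    walk j c (combine q (funToFin f))         ≡⟨ cong (λ (q , s) → position j c q (finToFun s)) (remQuot-combine {k = 2 ^ M} q (funToFin f)) ⟩
    position j c q (finToFun (funToFin f))    ≡⟨ position-cong j c q (finToFun-funToFin f) ⟩
    position j c q f                          ∎
    where open ≡-Reasoning

  -- Both lifts of the code of `ℓ`, with a 0 inserted at `j`, are steps at which type `j` explores
  -- `label ℓ`. As they are complementary away from `j`, one of them has bit `i` equal to 1, and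
  -- there type `i` waits.
  explore-while-waiting : ∀ {i j} → j ≢ i → ∀ c d ℓ →
    ∃[ t ] lookup (schedule (j , c)) t ≡ label ℓ × lookup (schedule (i , d)) t ≡ d
  explore-while-waiting {i} {j} j≢i c d ℓ = instant q f , explores , waits
    where
    open ≡-Reasoning
    q = proj₁ (remQuot {Q} (2 ^ m) ℓ)
    r = proj₂ (remQuot {Q} (2 ^ m) ℓ)
    v : Fin m → Fin 2
    v = finToFun r
    -- The place of bit `i` once bit `j` has been deleted.
    i′ = punchOut j≢i
    b = proj₁ (lift⊕-hits-1 v i′)
    f : Fin M → Fin 2
    f = insertAt (lift⊕ v b) j zero

    fi≡1 : f i ≡ suc zero
    fi≡1 = begin
      f i                    ≡⟨ cong f (punchIn-punchOut j≢i) ⟨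
      f (punchIn j i′)       ≡⟨ insertAt-punchIn (lift⊕ v b) j zero i′ ⟩
      lift⊕ v b i′           ≡⟨ proj₂ (lift⊕-hits-1 v i′) ⟩
      suc zero               ∎

    collapse-f : collapse (removeAt f j) ≗ v
    collapse-f k = trans
      (cong₂ _⊕_ (removeAt-insertAt (lift⊕ v b) j zero (suc k)) (removeAt-insertAt (lift⊕ v b) j zero zero))
      (⊕-cancelʳ (v k) b)

    explores : lookup (schedule (j , c)) (instant q f) ≡ label ℓ
    explores = begin
      lookup (schedule (j , c)) (instant q f)
        ≡⟨ lookup-schedule j c q f ⟩
      position j c q f
        ≡⟨ cong₂ (λ b w → choose b (label (combine q w)) c) (insertAt-lookup (lift⊕ v b) j zero) (funToFin-cong collapse-f) ⟩
      label (combine q (funToFin v))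
        ≡⟨ cong (λ w → label (combine q w)) (funToFin-finToFin {m} r) ⟩
      label (combine q r)
        ≡⟨ cong label (combine-remQuot {Q} (2 ^ m) ℓ) ⟩
      label ℓ ∎

    waits : lookup (schedule (i , d)) (instant q f) ≡ d
    waits = trans (lookup-schedule i d q f) (cong (λ b → choose b (label (combine q (funToFin (collapse (removeAt f i))))) d) fi≡1)

  types : List (Fin M × Fin n)
  types = cartesianProduct (allFin M) (allFin n)

  open Empirical types schedule public

  length-types : length types ≡ M * n
  length-types = trans (length-cartesianProduct (allFin M) (allFin n))
    (cong₂ _*_ (length-allFin M) (length-allFin n))

  -- Only meetings in which the first player explores and the second waits are counted. For each of
  -- the `M * n` choices of the first player there are `suc m` other types for the second, and for
  -- each of these `N` good waiting labels.
  meetings-≥ : {p : Vec (Fin n) n} → p ∈ perms n →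
    M * (n * (suc m * N)) ≤ ∑ types (λ s → ∑ types (λ s′ → 𝟙 (meets p (schedule s) (schedule s′))))
  meetings-≥ {p} p∈ = begin
    M * (n * (suc m * N))
      ≡⟨ cong (M *_) (∑-allFin-const n (suc m * N)) ⟨
    M * ∑ (allFin n) (λ _ → suc m * N)
      ≡⟨ ∑-allFin-const M (∑ (allFin n) (λ _ → suc m * N)) ⟨
    ∑ (allFin M) (λ _ → ∑ (allFin n) (λ _ → suc m * N))
      ≤⟨ ∑-mono-≤ (allFin M) (λ {j} _ → ∑-mono-≤ (allFin n) (λ {c} _ → partners j c)) ⟩
    ∑ (allFin M) (λ j → ∑ (allFin n) (λ c → hits j c))
      ≡⟨ ∑-cartesianProduct (λ (j , c) → hits j c) (allFin M) (allFin n) ⟨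
    ∑ types (λ s → ∑ types (λ s′ → 𝟙 (meets p (schedule s) (schedule s′)))) ∎
    where
    open ≤-Reasoning
    hits : Fin M → Fin n → ℕ
    hits j c = ∑ types (λ s′ → 𝟙 (meets p (schedule (j , c)) (schedule s′)))

    preimage : ∀ y → ∃[ x ] lookup p x ≡ y
    preimage = injective⇒surjective (lookup p) (perms-injective p∈)

    -- The second player's own name for the location that the first player calls `label ℓ`.
    waitingAt : Fin N → Fin n
    waitingAt ℓ = proj₁ (preimage (label ℓ))

    waitingAt-injective : Injective _≡_ _≡_ waitingAt
    waitingAt-injective {ℓ} {ℓ′} eq = inject≤-injective N≤n N≤n ℓ ℓ′
      (trans (sym (proj₂ (preimage (label ℓ)))) (trans (cong (lookup p) eq) (proj₂ (preimage (label ℓ′)))))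

    meet : ∀ {i j} → j ≢ i → ∀ c ℓ → meets p (schedule (j , c)) (schedule (i , waitingAt ℓ)) ≡ true
    meet {i} {j} j≢i c ℓ =
      let t , explores , waits = explore-while-waiting j≢i c (waitingAt ℓ) ℓ
      in meets-at p (schedule (j , c)) (schedule (i , waitingAt ℓ)) t
        (trans explores (trans (sym (proj₂ (preimage (label ℓ)))) (cong (lookup p) (sym waits))))

    met : Fin M → Fin n → Fin M → Fin n → ℕ
    met j c i d = 𝟙 (meets p (schedule (j , c)) (schedule (i , d)))

    met-≥ : ∀ {i j} → j ≢ i → ∀ c → N ≤ ∑ (allFin n) (met j c i)
    met-≥ {i} {j} j≢i c = begin
      N                             ≡⟨ *-identityʳ N ⟨
      N * 1                         ≤⟨ ∑-injection (met j c i) waitingAt waitingAt-injective 1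
                                         (λ ℓ → ≤-reflexive (sym (cong 𝟙 (meet j≢i c ℓ)))) ⟩
      ∑ (allFin n) (met j c i)      ∎

    partners : ∀ j c → suc m * N ≤ hits j c
    partners j c = begin
      suc m * N
        ≤⟨ ∑-injection (λ i → ∑ (allFin n) (met j c i)) (punchIn j) (punchIn-injective j _ _) N
             (λ i → met-≥ (punchInᵢ≢i j i ∘ sym) c) ⟩
      ∑ (allFin M) (λ i → ∑ (allFin n) (met j c i))
        ≡⟨ ∑-cartesianProduct (λ (i , d) → met j c i d) (allFin M) (allFin n) ⟨
      hits j c ∎

  successMass-≥ : length (perms n) * (M * (n * (suc m * N))) ≤ successMass weight
  successMass-≥ = begin
    length (perms n) * (M * (n * (suc m * N)))   ≡⟨ ∑-const (perms n) _ ⟨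
    ∑ (perms n) (λ _ → M * (n * (suc m * N)))    ≤⟨ ∑-mono-≤ (perms n) meetings-≥ ⟩
    _                                            ≡⟨ successMass-weight ⟨
    successMass weight                           ∎
    where open ≤-Reasoning

-- Estimates for the binary logarithm

2^⌊log₂n⌋≤n : ∀ n → 2 ^ ⌊log₂ suc n ⌋ ≤ suc n
2^⌊log₂n⌋≤n n = go n (<-wellFounded (suc n))
  where
  -- Quantifying over the accessibility proof lets the induction follow the recursion of `⌊log2⌋`
  -- itself, from `2 + n` to `suc ⌊ n /2⌋`.
  go : ∀ n (a : Acc _<_ (suc n)) → 2 ^ ⌊log2⌋ (suc n) a ≤ suc n
  go zero    _        = ≤-refl
  go (suc n) (acc rs) = begin
    2 * 2 ^ ⌊log2⌋ (suc ⌊ n /2⌋) _    ≤⟨ *-monoʳ-≤ 2 (go ⌊ n /2⌋ _) ⟩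
    2 * suc ⌊ n /2⌋                   ≡⟨ double ⌊ n /2⌋ ⟩
    2 + (⌊ n /2⌋ + ⌊ n /2⌋)           ≤⟨ +-monoʳ-≤ 2 (+-monoʳ-≤ ⌊ n /2⌋ (⌊n/2⌋≤⌈n/2⌉ n)) ⟩
    2 + (⌊ n /2⌋ + ⌈ n /2⌉)           ≡⟨ cong (2 +_) (⌊n/2⌋+⌈n/2⌉≡n n) ⟩
    2 + n                             ∎
    where
    open ≤-Reasoning
    double : ∀ h → 2 * suc h ≡ 2 + (h + h)
    double = solve-∀

1+n≤2^n : ∀ n → suc n ≤ 2 ^ n
1+n≤2^n zero    = ≤-refl
1+n≤2^n (suc n) = begin
  1 + suc n       ≤⟨ +-mono-≤ (≤-trans (s≤s z≤n) (1+n≤2^n n)) (1+n≤2^n n) ⟩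
  2 ^ n + 2 ^ n   ≡⟨ cong (2 ^ n +_) (+-identityʳ (2 ^ n)) ⟨
  2 ^ suc n       ∎
  where open ≤-Reasoning

⌈n/2⌉≤1+⌊n/2⌋ : ∀ n → ⌈ n /2⌉ ≤ suc ⌊ n /2⌋
⌈n/2⌉≤1+⌊n/2⌋ zero          = z≤n
⌈n/2⌉≤1+⌊n/2⌋ (suc zero)    = ≤-refl
⌈n/2⌉≤1+⌊n/2⌋ (suc (suc n)) = s≤s (⌈n/2⌉≤1+⌊n/2⌋ n)

n≤2+2⌊n/2⌋ : ∀ n → n ≤ 2 * suc ⌊ n /2⌋
n≤2+2⌊n/2⌋ n = begin
  n                                 ≡⟨ ⌊n/2⌋+⌈n/2⌉≡n n ⟨
  ⌊ n /2⌋ + ⌈ n /2⌉                 ≤⟨ +-mono-≤ (n≤1+n ⌊ n /2⌋) (⌈n/2⌉≤1+⌊n/2⌋ n) ⟩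
  suc ⌊ n /2⌋ + suc ⌊ n /2⌋         ≡⟨ cong (suc ⌊ n /2⌋ +_) (+-identityʳ (suc ⌊ n /2⌋)) ⟨
  2 * suc ⌊ n /2⌋                   ∎
  where open ≤-Reasoning

ℓ2^⌊ℓ/2⌋≤2·2^ℓ : ∀ ℓ → ℓ * 2 ^ ⌊ ℓ /2⌋ ≤ 2 * 2 ^ ℓ
ℓ2^⌊ℓ/2⌋≤2·2^ℓ ℓ = begin
  ℓ * 2 ^ h               ≤⟨ *-monoˡ-≤ (2 ^ h) (≤-trans (n≤2+2⌊n/2⌋ ℓ) (*-monoʳ-≤ 2 (1+n≤2^n h))) ⟩
  2 * 2 ^ h * 2 ^ h       ≡⟨ *-assoc 2 (2 ^ h) (2 ^ h) ⟩
  2 * (2 ^ h * 2 ^ h)     ≡⟨ cong (2 *_) (^-distribˡ-+-* 2 h h) ⟨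
  2 * 2 ^ (h + h)         ≤⟨ *-monoʳ-≤ 2 (^-monoʳ-≤ 2 (subst (h + h ≤_) (⌊n/2⌋+⌈n/2⌉≡n ℓ) (+-monoʳ-≤ h (⌊n/2⌋≤⌈n/2⌉ ℓ)))) ⟩
  2 * 2 ^ ℓ               ∎
  where
  open ≤-Reasoning
  h = ⌊ ℓ /2⌋

-- ℓ times the failure probability 1 − (m/M)(N/n), with M = 1 + m types, after clearing the
-- denominator M n.
failure-bound : ∀ ℓ m n N R → ℓ ≤ 2 * suc m → ℓ * R ≤ 2 * n → n ≤ R + N →
                ℓ * (suc m * n) ≤ ℓ * (m * N) + 4 * (suc m * n)
failure-bound ℓ m n N R ℓ≤ ℓR≤ n≤ = begin
  ℓ * (suc m * n)                                   ≡⟨ e₁ ℓ m n ⟩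
  -- The first summand pays for coinciding types. In the second, `n` is split into at most `R`
  -- unexplored labels and `N` explored ones.
  ℓ * n + ℓ * (m * n)                               ≤⟨ +-mono-≤ (*-monoˡ-≤ n ℓ≤) (*-monoʳ-≤ ℓ (*-monoʳ-≤ m n≤)) ⟩
  2 * suc m * n + ℓ * (m * (R + N))                 ≡⟨ e₂ ℓ m n N R ⟩
  ℓ * (m * N) + (2 * suc m * n + m * (ℓ * R))       ≤⟨ +-monoʳ-≤ (ℓ * (m * N)) (+-monoʳ-≤ (2 * suc m * n) (*-mono-≤ (n≤1+n m) ℓR≤)) ⟩
  ℓ * (m * N) + (2 * suc m * n + suc m * (2 * n))   ≡⟨ e₃ ℓ m n N ⟩
  ℓ * (m * N) + 4 * (suc m * n)                     ∎
  where
  open ≤-Reasoning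
  e₁ : ∀ ℓ m n → ℓ * (suc m * n) ≡ ℓ * n + ℓ * (m * n)
  e₁ = solve-∀
  e₂ : ∀ ℓ m n N R → 2 * suc m * n + ℓ * (m * (R + N)) ≡ ℓ * (m * N) + (2 * suc m * n + m * (ℓ * R))
  e₂ = solve-∀
  e₃ : ∀ ℓ m n N → ℓ * (m * N) + (2 * suc m * n + suc m * (2 * n)) ≡ ℓ * (m * N) + 4 * (suc m * n)
  e₃ = solve-∀

-- Choice of parameters

theorem4 : ∃[ K ] ((n : ℕ) → 2 ≤ n →
    ∃[ w ] ((0 < totalWeight {n} {4 * n} w)
    × (⌊log₂ n ⌋ * (totalWeight w * totalWeight w * length (perms n))
    ≤ ⌊log₂ n ⌋ * successMass w
    + K * (totalWeight w * totalWeight w * length (perms n)))))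
-- Coinciding types and an unexplored waiting place each cost at most 2/`ℓ`, where `ℓ` is the
-- logarithm of `n`.
theorem4 = 4 , proof
  where
  proof : (n : ℕ) → 2 ≤ n →
    ∃[ w ] ((0 < totalWeight {n} {4 * n} w)
    × (⌊log₂ n ⌋ * (totalWeight w * totalWeight w * length (perms n))
    ≤ ⌊log₂ n ⌋ * successMass w
    + 4 * (totalWeight w * totalWeight w * length (perms n))))
  proof n@(suc n-1) _ = weight , subst (0 <_) (sym W≡) (s≤s z≤n) , bound
    where
    ℓ = ⌊log₂ n ⌋
    -- Halving balances the two losses: the number of types stays of order log `n`, while the block
    -- size `R` is only about the square root of `n`.
    h = ⌊ ℓ /2⌋
    R = 2 ^ h
    instance
      R≢0 : NonZero R
      R≢0 = m^n≢0 2 h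
    -- As many whole blocks as fit into the `n` labels; only the remainder `n % R` stays unexplored.
    open Strategy (n / R) h n (m/n*n≤m n R)
    P = length (perms n)
    W≡ : totalWeight weight ≡ M * n
    W≡ = trans totalWeight-weight length-types

    core : ℓ * (M * n) ≤ ℓ * (suc h * N) + 4 * (M * n)
    -- The argument is `suc h`, the number of types other than the player's own, since `M` is
    -- `2 + h`.
    core = failure-bound ℓ (suc h) n N R
      (≤-trans (n≤2+2⌊n/2⌋ ℓ) (*-monoʳ-≤ 2 (n≤1+n (suc h))))
      (≤-trans (ℓ2^⌊ℓ/2⌋≤2·2^ℓ ℓ) (*-monoʳ-≤ 2 (2^⌊log₂n⌋≤n n-1)))
      (≤-trans (≤-reflexive (m≡m%n+[m/n]*n n R)) (+-monoˡ-≤ N (m%n≤n n R)))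

    open ≤-Reasoning
    bound : ℓ * (totalWeight weight * totalWeight weight * P)
          ≤ ℓ * successMass weight + 4 * (totalWeight weight * totalWeight weight * P)
    bound = subst (λ W → ℓ * (W * W * P) ≤ ℓ * successMass weight + 4 * (W * W * P)) (sym W≡) (begin
      ℓ * (M * n * (M * n) * P)
        ≡⟨ e₁ ℓ (M * n) P ⟩
      M * n * P * (ℓ * (M * n))
        -- The total mass `M * n` occurs squared; one copy and `P` are common factors, and the other
        -- is the denominator cleared in `core`.
        ≤⟨ *-monoʳ-≤ (M * n * P) core ⟩
      M * n * P * (ℓ * (suc h * N) + 4 * (M * n))
        ≡⟨ e₂ ℓ M n P (suc h * N) ⟩
      ℓ * (P * (M * (n * (suc h * N)))) + 4 * (M * n * (M * n) * P)
        ≤⟨ +-monoˡ-≤ _ (*-monoʳ-≤ ℓ successMass-≥) ⟩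
      ℓ * successMass weight + 4 * (M * n * (M * n) * P) ∎)
      where
      e₁ : ∀ l w p → l * (w * w * p) ≡ w * p * (l * w)
      e₁ = solve-∀
      e₂ : ∀ l a b p c → a * b * p * (l * c + 4 * (a * b)) ≡ l * (p * (a * (b * c))) + 4 * (a * b * (a * b) * p)
      e₂ = solve-∀
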